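{- For every $n\ge1$, the six pairs of set-valued statistics $(\mathrm{Cyc_B},\mathrm{Rmil_B})$, $(\mathrm{Cyc_B},\mathrm{Lmap_B})$, $(\mathrm{Rmil_B},\mathrm{Lmap_B})$, $(\mathrm{Lmap_B},\mathrm{Rmil_B})$, $(\mathrm{Lmap_B},\mathrm{Cyc_B})$ and $(\mathrm{Rmil_B},\mathrm{Cyc_B})$ are equidistributed over $B_n$; that is, for any two subsets $X,Y\subseteq[n]$, the number of $\sigma\in B_n$ with $(S_1\sigma,S_2\sigma)=(X,Y)$ is the same for each of these six pairs $(S_1,S_2)$.
   Context: $B_n$: bijections $\sigma$ of $\{\pm1,\ldots,\pm n\}$ with $\sigma(-i)=-\sigma(i)$, written $\sigma_1\cdots\sigma_n$, $\sigma_i=\sigma(i)$. $\mathrm{Lmap_B}\,\sigma=\{i:\sigma_i>|\sigma_j|\text{ for all }j<i\}$. $\mathrm{Rmil_B}\,\sigma=\{\sigma_i:0<\sigma_i<|\sigma_j|\text{ for all }j>i\}$. $\mathrm{Cyc_B}\,\sigma$ is the set of minimal elements of those cycles $C$ of the permutation $i\mapsto|\sigma(i)|$ of $[n]$ for which the number of $i\in C$ with $\sigma(i)<0$ is even.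
   Formalization: Lmap_B is taken with the convention σ_0 = 0, so i = 1 belongs to it only if σ_1 > 0; read literally, 1 would always lie in Lmap_B, and the claim fails for n = 1 (σ = −1 gives Cyc_B = Rmil_B = ∅ but Lmap_B = {1}). -}

module Defs where

open import Data.Bool using (Bool; true; false; not; _∧_; _∨_; if_then_else_; T)
open import Data.Bool.Properties using (T?) renaming (_≟_ to _≟ᵇ_)
open import Data.Nat using (ℕ; zero; suc; _<ᵇ_)
open import Data.Fin using (Fin; toℕ; _≟_)
open import Data.Fin.Subset using (Subset)
open import Data.Product using (_×_; _,_; proj₁; proj₂)
open import Data.Product.Relation.Binary.Pointwise.NonDependent using ()
open import Data.List using (List; []; _∷_; map; length; allFin; concatMap; filter; foldr)
open import Data.Bool.ListAction using (all; any)
open import Data.Vec using (Vec; []; _∷_; lookup; tabulate)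
open import Data.Vec.Properties using (≡-dec)
open import Relation.Nullary using (does)
open import Relation.Nullary.Decidable using (_×-dec_)
open import Relation.Binary.PropositionalEquality using (_≡_)

-- A signed word of length n: entry i is (s , a) standing for the value
--   σ_{i+1} = (if s then -1 else +1) * (toℕ a + 1).
-- So `true` means negative, and positions / absolute values are 0-based Fin n.
SignedWord : ℕ → Set
SignedWord n = Vec (Bool × Fin n) n

neg : ∀ {n} → SignedWord n → Fin n → Bool
neg w i = proj₁ (lookup w i)

absv : ∀ {n} → SignedWord n → Fin n → Fin n
absv w i = proj₂ (lookup w i)

_≟ᶠ_ : ∀ {n} → Fin n → Fin n → Bool
i ≟ᶠ j = does (i ≟ j)

_<ᶠ_ : ∀ {n} → Fin n → Fin n → Bool
i <ᶠ j = toℕ i <ᵇ toℕ j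

isSignedPerm : ∀ {n} → SignedWord n → Bool
isSignedPerm {n} w =
  all (λ i → all (λ j → not (i <ᶠ j) ∨ not (absv w i ≟ᶠ absv w j)) (allFin n)) (allFin n)

allVecs : ∀ {A : Set} → List A → (m : ℕ) → List (Vec A m)
allVecs xs zero = [] ∷ []
allVecs xs (suc m) = concatMap (λ x → map (x ∷_) (allVecs xs m)) xs

allSignedWords : (n : ℕ) → List (SignedWord n)
allSignedWords n =
  allVecs (concatMap (λ s → map (s ,_) (allFin n)) (true ∷ false ∷ [])) n

-- Lmap_B σ = { i : σ_i > |σ_j| for all j < i }  (with σ_0 = 0, so σ_i > 0)
Lmap : ∀ {n} → SignedWord n → Subset n
Lmap {n} w = tabulate λ i →
  not (neg w i) ∧ all (λ j → not (j <ᶠ i) ∨ (absv w j <ᶠ absv w i)) (allFin n)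

Rmil : ∀ {n} → SignedWord n → Subset n
Rmil {n} w = tabulate λ v →
  any (λ i → (absv w i ≟ᶠ v) ∧ not (neg w i)
             ∧ all (λ j → not (i <ᶠ j) ∨ (v <ᶠ absv w j)) (allFin n))
      (allFin n)

-- the orbit of i under a ↦ |σ(a)|, walking from π(i) until returning to i
-- (with fuel n, enough for a permutation of [n])
orbitTail : ∀ {n} → SignedWord n → Fin n → ℕ → Fin n → List (Fin n)
orbitTail w i zero x = []
orbitTail w i (suc k) x = if x ≟ᶠ i then [] else x ∷ orbitTail w i k (absv w x)

orbit : ∀ {n} → SignedWord n → Fin n → List (Fin n)
orbit {n} w i = i ∷ orbitTail w i n (absv w i)

even : ℕ → Bool
even zero = true
even (suc k) = not (even k)

Cyc : ∀ {n} → SignedWord n → Subset n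
Cyc w = tabulate λ i →
  all (λ x → not (x <ᶠ i)) (orbit w i)
  ∧ even (length (filterNeg (orbit w i)))
  where
    filterNeg : List _ → List _
    filterNeg = foldr (λ x r → if neg w x then x ∷ r else r) []

countPair : (n : ℕ) → (S₁ S₂ : SignedWord n → Subset n) → Subset n → Subset n → ℕ
countPair n S₁ S₂ X Y = length (filter
  (λ w → T? (isSignedPerm w) ×-dec (≡-dec _≟ᵇ_ (S₁ w) X ×-dec ≡-dec _≟ᵇ_ (S₂ w) Y))
  (allSignedWords n))

{-# OPTIONS --safe #-}
-- Inverting σ exchanges Rmil and Lmap and preserves Cyc, so up to the order of the two
-- statistics only (Lmap, Rmil) ~ (Cyc, Lmap) remains. Both pairs obey the same recursion:
-- * appending a last letter ±p to a word of length n - 1 (after standardization) adds n to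
--   Lmap exactly when the letter is +n, and turns Rmil into (Rmil ∩ [1, p-1]) ∪ {p if +};
-- * inserting n in the cycle structure with letter ±n at position p, in a way that keeps the
--   sign product of the cycle, adds n to Cyc exactly when p = n with sign +, and turns Lmap
--   into (Lmap ∩ [1, p-1]) ∪ {p if +}.
-- Matching the insertions step by step gives an injection of Bₙ into itself, hence a bijection.
module Submission where

open import Defs
open import Data.Nat using (ℕ; _≤_)
open import Data.Fin.Subset using (Subset)
open import Data.Product using (_×_)
open import Relation.Binary.PropositionalEquality using (_≡_)
open import Data.Bool using (Bool; true; false; T; not; _∧_; _∨_; _xor_; if_then_else_)
open import Data.Bool.ListAction using (all; any)
open import Data.Bool.Properties
  using (T?; T-∧; T-≡; T-not-≡; xor-assoc; xor-comm; xor-same; xor-identityʳ; not-involutive)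
  renaming (_≟_ to _≟ᵇ_)
open import Data.Fin as Fin
  using (Fin; zero; suc; toℕ; fromℕ; inject₁; punchIn; punchOut; _<_; _≟_)
open import Data.Fin.Properties
  using ( toℕ-injective; toℕ-inject₁; toℕ-fromℕ; toℕ<n; ≤fromℕ; inject₁-injective; fromℕ≢inject₁
        ; punchIn-mono-≤; punchIn-cancel-≤; punchIn-punchOut; pigeonhole; <-cmp; <-irrefl; <-asym)
open import Data.Fin.Relation.Unary.Top using (View; view; view-inject₁; ‵fromℕ; ‵inject₁)
open import Data.Fin.Subset using (_∈_)
open import Data.Fin.Subset.Properties using (⊆-antisym)
open import Data.List
  using (List; []; _∷_; _++_; map; length; filter; foldr; concatMap; allFin; cartesianProductWith)
import Data.List.Membership.Propositional as List
open import Data.List.Membership.Propositional.Properties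
  using (∈-∃++; ∈-++⁻; ∈-++⁺ˡ; ∈-++⁺ʳ; ∈-filter⁺; ∈-filter⁻; ∈-allFin; ∈-cartesianProductWith⁺)
open import Data.List.Properties using (filter-≐)
open import Data.List.Relation.Binary.Permutation.Propositional
  using (_↭_; ↭-refl; ↭-sym; ↭-trans; prep)
open import Data.List.Relation.Binary.Permutation.Propositional.Properties
  using (filter-↭; ↭-length; shift)
open import Data.List.Relation.Binary.Pointwise using (Pointwise; []; _∷_; Pointwise-length)
open import Data.List.Relation.Unary.All as All using (All; []; _∷_)
open import Data.List.Relation.Unary.All.Properties using (all⁺; all⁻)
open import Data.List.Relation.Unary.AllPairs using ([]; _∷_)
open import Data.List.Relation.Unary.Any using (here; there)
open import Data.List.Relation.Unary.Any.Properties using (any⁺; any⁻)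
open import Data.List.Relation.Unary.Unique.Propositional using (Unique)
import Data.List.Relation.Unary.Unique.Propositional.Properties as Unique
open import Data.Nat as ℕ using (zero; suc; s≤s)
open import Data.Nat.GeneralisedArithmetic using (fold)
import Data.Nat.Properties as ℕ
open import Data.Product using (_,_; proj₁; proj₂; ∃; ∃-syntax; map₂; swap)
open import Data.Product.Function.NonDependent.Propositional using (_×-⇔_)
open import Data.Product.Properties using (,-injective)
open import Data.Sum as Sum using (_⊎_; inj₁; inj₂)
open import Data.Unit using (⊤)
open import Data.Vec using (Vec; []; _∷_; lookup; tabulate; _[_]≔_)
open import Data.Vec.Properties
  using ( ≡-dec; ∷-injective; lookup∘tabulate; tabulate∘lookup; tabulate-cong
        ; []=⇒lookup; lookup⇒[]=; lookup∘updateAt; lookup∘updateAt′)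
open import Function using (_∘_; _⇔_; mk⇔; Equivalence; Injective)
open import Function.Properties.Equivalence using () renaming (sym to ⇔-sym; trans to ⇔-trans)
open import Level using (0ℓ)
open import Relation.Binary using (REL; Rel; tri<; tri≈; tri>)
open import Relation.Binary.PropositionalEquality
  using (_≢_; refl; sym; trans; cong; cong₂; subst; subst₂; module ≡-Reasoning)
open import Relation.Nullary using (¬_; yes; no; does; contradiction)
open import Relation.Nullary.Decidable using (_×-dec_)
open import Relation.Unary using (Pred; Decidable)

open Equivalence using (to; from)

private variable
  A B C : Set
  n : ℕ

-- The enumeration of signed words is complete and free of repetitions.

concatMap-map : (f : A → B → C) (xs : List A) (ys : List B) →
  concatMap (λ x → map (f x) ys) xs ≡ cartesianProductWith f xs ys
concatMap-map f []       ys = refl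
concatMap-map f (x ∷ xs) ys = cong (map (f x) ys ++_) (concatMap-map f xs ys)

concatMap-unique : (f : A → B → C) → (∀ {w x y z} → f w y ≡ f x z → w ≡ x × y ≡ z) →
  ∀ {xs ys} → Unique xs → Unique ys → Unique (concatMap (λ x → map (f x) ys) xs)
concatMap-unique f f-inj {xs} {ys} xs! ys! =
  subst Unique (sym (concatMap-map f xs ys)) (Unique.cartesianProductWith⁺ f f-inj xs! ys!)

∈-concatMap-map : (f : A → B → C) → ∀ {xs ys a b} → a List.∈ xs → b List.∈ ys →
  f a b List.∈ concatMap (λ x → map (f x) ys) xs
∈-concatMap-map f {xs} {ys} a∈ b∈ =
  subst (_ List.∈_) (sym (concatMap-map f xs ys)) (∈-cartesianProductWith⁺ f a∈ b∈)

allVecs-unique : {xs : List A} → Unique xs → ∀ m → Unique (allVecs xs m)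
allVecs-unique xs! zero    = [] ∷ []
allVecs-unique xs! (suc m) = concatMap-unique _∷_ ∷-injective xs! (allVecs-unique xs! m)

∈-allVecs : {xs : List A} → (∀ x → x List.∈ xs) → ∀ {m} (v : Vec A m) → v List.∈ allVecs xs m
∈-allVecs x∈ []      = here refl
∈-allVecs x∈ (a ∷ v) = ∈-concatMap-map _∷_ (x∈ a) (∈-allVecs x∈ v)

allSignedWords-unique : ∀ n → Unique (allSignedWords n)
allSignedWords-unique n = allVecs-unique
  (concatMap-unique _,_ ,-injective (((λ ()) ∷ []) ∷ [] ∷ []) (Unique.allFin⁺ n)) n

∈-allSignedWords : ∀ {n} (w : SignedWord n) → w List.∈ allSignedWords n
∈-allSignedWords = ∈-allVecs λ (s , a) → ∈-concatMap-map _,_ (∈-bools s) (∈-allFin a)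
  where
  ∈-bools : ∀ s → s List.∈ (true ∷ false ∷ [])
  ∈-bools true  = here refl
  ∈-bools false = there (here refl)

-- Counting along an injective relation on a finite set.

∈-remove : ∀ {x y : A} xs {ys} → y List.∈ xs ++ x ∷ ys → x ≢ y → y List.∈ xs ++ ys
∈-remove xs y∈ x≢y with ∈-++⁻ xs y∈
... | inj₁ y∈xs         = ∈-++⁺ˡ y∈xs
... | inj₂ (here refl)  = contradiction refl x≢y
... | inj₂ (there y∈ys) = ∈-++⁺ʳ xs y∈ys

-- Induction on `xs`: the occurrence of the head `x` is cut out of `ys`. The tail of `xs` still lies
-- in what remains, since it does not contain `x`.
unique∧⊆∧length⇒↭ : {xs ys : List A} → Unique xs → (∀ {x} → x List.∈ xs → x List.∈ ys) →
  length xs ≡ length ys → xs ↭ ys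
unique∧⊆∧length⇒↭ {ys = []} []  _ _ = ↭-refl
unique∧⊆∧length⇒↭ {xs = x ∷ xs} (x∉xs ∷ xs!) xs⊆ys ∣xs∣≡∣ys∣
  with as , bs , refl ← ∈-∃++ (xs⊆ys (here refl)) =
  ↭-trans (prep x (unique∧⊆∧length⇒↭ xs!
      (λ y∈xs → ∈-remove as (xs⊆ys (there y∈xs)) (All.lookup x∉xs y∈xs))
      (ℕ.suc-injective (trans ∣xs∣≡∣ys∣ (↭-length (shift x as bs))))))
    (↭-sym (shift x as bs))

-- Separates the test for signed permutations from the test on the statistics, so that one list of
-- signed permutations serves for all pairs.
filter-× : ∀ {P Q : Pred A 0ℓ} (P? : Decidable P) (Q? : Decidable Q) xs →
  filter (λ x → P? x ×-dec Q? x) xs ≡ filter Q? (filter P? xs)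
filter-× P? Q? [] = refl
filter-× P? Q? (x ∷ xs) with does (P? x)
... | false = filter-× P? Q? xs
... | true with does (Q? x)
...   | false = filter-× P? Q? xs
...   | true  = cong (x ∷_) (filter-× P? Q? xs)

module _ {R : REL A B 0ℓ} where

  Pointwise-∈ʳ : ∀ {xs ys} → Pointwise R xs ys → ∀ {y} → y List.∈ ys → ∃[ x ] x List.∈ xs × R x y
  Pointwise-∈ʳ (r ∷ rs) (here refl) = _ , here refl , r
  Pointwise-∈ʳ (r ∷ rs) (there y∈)  with x , x∈ , r′ ← Pointwise-∈ʳ rs y∈ = x , there x∈ , r′

  Pointwise-unique : (∀ {x x′ y} → R x y → R x′ y → x ≡ x′) →
    ∀ {xs ys} → Pointwise R xs ys → Unique xs → Unique ys
  Pointwise-unique R-inj []       []          = []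
  Pointwise-unique R-inj (r ∷ rs) (x∉xs ∷ xs!) =
    All.tabulate (λ y∈ys y≡ → let x , x∈ , r′ = Pointwise-∈ʳ rs y∈ys in
      All.lookup x∉xs x∈ (R-inj r (subst (R x) (sym y≡) r′)))
    ∷ Pointwise-unique R-inj rs xs!

  -- One image is chosen for each entry, so `R` may be a relation and need not be given as a
  -- function.
  Pointwise-image : ∀ {xs} → All (λ x → ∃ (R x)) xs → ∃ (Pointwise R xs)
  Pointwise-image []             = [] , []
  Pointwise-image ((y , r) ∷ rs) with ys , rs′ ← Pointwise-image rs = y ∷ ys , r ∷ rs′

  length-filter-Pointwise : ∀ {P : Pred A 0ℓ} {Q : Pred B 0ℓ} (P? : Decidable P) (Q? : Decidable Q) →
    (∀ {x y} → R x y → P x ⇔ Q y) →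
    ∀ {xs ys} → Pointwise R xs ys → length (filter P? xs) ≡ length (filter Q? ys)
  length-filter-Pointwise P? Q? P⇔Q [] = refl
  length-filter-Pointwise P? Q? P⇔Q {x ∷ _} {y ∷ _} (r ∷ rs) with P? x | Q? y
  ... | yes p | yes q = cong suc (length-filter-Pointwise P? Q? P⇔Q rs)
  ... | no ¬p | no ¬q = length-filter-Pointwise P? Q? P⇔Q rs
  ... | yes p | no ¬q = contradiction (to (P⇔Q r) p) ¬q
  ... | no ¬p | yes q = contradiction (from (P⇔Q r) q) ¬p

IsSignedPerm : ∀ {n} → SignedWord n → Set
IsSignedPerm w = T (isSignedPerm w)

-- R is injective from a finite set to itself, hence a bijection of signed permutations.
countPair-cong : ∀ {n} {S₁ S₂ T₁ T₂ : SignedWord n → Subset n} (R : Rel (SignedWord n) 0ℓ) →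
  (∀ w → IsSignedPerm w → ∃[ u ] IsSignedPerm u × R w u) →
  (∀ {w w′ u} → R w u → R w′ u → w ≡ w′) →
  (∀ {w u} → IsSignedPerm w → IsSignedPerm u → R w u → S₁ w ≡ T₁ u × S₂ w ≡ T₂ u) →
  ∀ X Y → countPair n S₁ S₂ X Y ≡ countPair n T₁ T₂ X Y
countPair-cong {n} {S₁} {S₂} {T₁} {T₂} R total inj stats X Y = begin
  countPair n S₁ S₂ X Y
    ≡⟨ cong length (filter-× SP? (pair? S₁ S₂) words) ⟩
  length (filter (pair? S₁ S₂) perms)
    ≡⟨ length-filter-Pointwise (pair? S₁ S₂) (pair? T₁ T₂) pair⇔ R-perms-images ⟩
  length (filter (pair? T₁ T₂) images)
    ≡⟨ ↭-length (filter-↭ (pair? T₁ T₂) images↭perms) ⟩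
  length (filter (pair? T₁ T₂) perms)
    ≡⟨ cong length (filter-× SP? (pair? T₁ T₂) words) ⟨
  countPair n T₁ T₂ X Y
    ∎
  where
  open ≡-Reasoning
  words = allSignedWords n

  SP? : Decidable (IsSignedPerm {n})
  SP? w = T? (isSignedPerm w)

  pair? : (U₁ U₂ : SignedWord n → Subset n) → Decidable λ w → U₁ w ≡ X × U₂ w ≡ Y
  pair? U₁ U₂ w = ≡-dec _≟ᵇ_ (U₁ w) X ×-dec ≡-dec _≟ᵇ_ (U₂ w) Y

  perms = filter SP? words

  perm∈ : ∀ {w} → w List.∈ perms → IsSignedPerm w
  perm∈ {w} = proj₂ ∘ ∈-filter⁻ SP? {v = w} {xs = words}

  R⁺ : Rel (SignedWord n) 0ℓ
  R⁺ w u = IsSignedPerm w × IsSignedPerm u × R w u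

  image = Pointwise-image {R = R⁺} (All.tabulate λ {w} w∈ →
    let p = perm∈ w∈ ; u , q , r = total w p in u , p , q , r)
  images         = proj₁ image
  R-perms-images = proj₂ image

  pair⇔ : ∀ {w u} → R⁺ w u → (S₁ w ≡ X × S₂ w ≡ Y) ⇔ (T₁ u ≡ X × T₂ u ≡ Y)
  pair⇔ (p , q , r) with e₁ , e₂ ← stats p q r =
    mk⇔ (λ (a , b) → trans (sym e₁) a , trans (sym e₂) b)
        (λ (a , b) → trans e₁ a , trans e₂ b)

  -- Finiteness enters here: the images are distinct signed permutations, as many as there are
  -- signed permutations in all.
  images↭perms : images ↭ perms
  images↭perms = unique∧⊆∧length⇒↭
    (Pointwise-unique (λ (_ , _ , r) (_ , _ , r′) → inj r r′) R-perms-images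
      (Unique.filter⁺ SP? (allSignedWords-unique n)))
    (λ u∈ → let _ , _ , _ , q , _ = Pointwise-∈ʳ R-perms-images u∈ in
      ∈-filter⁺ SP? (∈-allSignedWords _) q)
    (sym (Pointwise-length R-perms-images))

-- Extensionality and reflection of Boolean tests into propositions.

vec-ext : {A : Set} {v w : Vec A n} → (∀ i → lookup v i ≡ lookup w i) → v ≡ w
vec-ext {v = v} {w} eq = trans (sym (tabulate∘lookup v)) (trans (tabulate-cong eq) (tabulate∘lookup w))

module _ {a b} {A B : Set} (ra : T a ⇔ A) (rb : T b ⇔ B) where

  reflect-⇒ : T (not a ∨ b) ⇔ (A → B)
  reflect-⇒ = mk⇔ (λ t → to rb ∘ T-⇒ t ∘ from ra) (λ f → ⇒-T (from rb ∘ f ∘ to ra))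
    where
    T-⇒ : ∀ {a b} → T (not a ∨ b) → T a → T b
    T-⇒ {true} t _ = t
    ⇒-T : ∀ {a b} → (T a → T b) → T (not a ∨ b)
    ⇒-T {true}  f = f _
    ⇒-T {false} _ = _

  reflect-∧ : T (a ∧ b) ⇔ (A × B)
  reflect-∧ = ⇔-trans T-∧ (ra ×-⇔ rb)

reflect-not : ∀ {a} {A : Set} → T a ⇔ A → T (not a) ⇔ (¬ A)
reflect-not {true}  r = mk⇔ (λ ()) (λ ¬A → ¬A (to r _))
reflect-not {false} r = mk⇔ (λ _ → from r) (λ _ → _)

reflect-< : {i j : Fin n} → T (i <ᶠ j) ⇔ i < j
reflect-< = mk⇔ (ℕ.<ᵇ⇒< _ _) ℕ.<⇒<ᵇ

reflect-≟ : {i j : Fin n} → T (i ≟ᶠ j) ⇔ i ≡ j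
reflect-≟ {i = i} {j} with i ≟ j
... | yes i≡j = mk⇔ (λ _ → i≡j) (λ _ → _)
... | no  i≢j = mk⇔ (λ ()) i≢j

module _ {f : Fin n → Bool} {P : Fin n → Set} (r : ∀ i → T (f i) ⇔ P i) where

  reflect-all : T (all f (allFin n)) ⇔ (∀ i → P i)
  reflect-all = mk⇔ (λ t i → to (r i) (All.lookup (all⁺ f (allFin n) t) (∈-allFin i)))
                    (λ h → all⁻ f {allFin n} (All.tabulate λ {i} _ → from (r i) (h i)))

  reflect-any : T (any f (allFin n)) ⇔ ∃ P
  reflect-any = mk⇔ (λ t → let i , _ , ti = List.find (any⁻ f (allFin n) t) in i , to (r i) ti)
                    (λ (i , p) → any⁺ f (List.lose (∈-allFin i) (from (r i) p)))

-- Here `b` is the sign at the start of an orbit and `e` the evenness of the negative letters in the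
-- rest; `b` flips the total.
T-even-flip : ∀ b {e} → T (if b then not e else e) ⇔ e ≡ not b
T-even-flip true  = T-not-≡
T-even-flip false = T-≡

∈-tabulate : ∀ {f : Fin n → Bool} {i} → i ∈ tabulate f ⇔ T (f i)
∈-tabulate {f = f} {i} = mk⇔
  (λ i∈ → from T-≡ (trans (sym (lookup∘tabulate f i)) ([]=⇒lookup i∈)))
  (λ t → lookup⇒[]= i _ (trans (lookup∘tabulate f i) (to T-≡ t)))

subset-ext : {X Y : Subset n} → (∀ i → i ∈ X ⇔ i ∈ Y) → X ≡ Y
subset-ext h = ⊆-antisym (λ {i} → to (h i)) (λ {i} → from (h i))

-- Signed permutations and the statistics as propositions.

AbsInjective : SignedWord n → Set
AbsInjective w = Injective _≡_ _≡_ (absv w)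

-- The Boolean test compares only positions `i < j`; trichotomy recovers injectivity from it.
isSignedPerm⇔ : (w : SignedWord n) → IsSignedPerm w ⇔ AbsInjective w
isSignedPerm⇔ w = ⇔-trans
  (reflect-all λ i → reflect-all λ j →
    reflect-⇒ (reflect-< {i = i} {j}) (reflect-not (reflect-≟ {i = absv w i} {absv w j})))
  (mk⇔ ⇒ (λ inj i j i<j → (λ i≡j → <-irrefl i≡j i<j) ∘ inj))
  where
  ⇒ : (∀ i j → i < j → absv w i ≢ absv w j) → AbsInjective w
  ⇒ h {i} {j} eq with <-cmp i j
  ... | tri≈ _ i≡j _ = i≡j
  ... | tri< i<j _ _ = contradiction eq (h i j i<j)
  ... | tri> _ _ j<i = contradiction (sym eq) (h j i j<i)

IsLmap : SignedWord n → Fin n → Set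
IsLmap w i = neg w i ≡ false × (∀ j → j < i → absv w j < absv w i)

IsRmil : SignedWord n → Fin n → Set
IsRmil w v = ∃[ i ] absv w i ≡ v × neg w i ≡ false × (∀ j → i < j → v < absv w j)

-- A walk under |w| from x that stays above i until it hits i; the flag is the
-- parity (true = odd) of the number of negative letters met before i.
data Return (w : SignedWord n) (i : Fin n) : Fin n → Bool → Set where
  stop : Return w i i false
  step : ∀ {x y d e} → i < x → lookup w x ≡ (d , y) → Return w i y e → Return w i x (d xor e)

-- The cycle has evenly many negative letters iff the parity of its part after i is the sign at i.
IsCyc : SignedWord n → Fin n → Set
IsCyc w i = Return w i (absv w i) (neg w i)

∈-Lmap : ∀ (w : SignedWord n) {i} → i ∈ Lmap w ⇔ IsLmap w i
∈-Lmap w {i} = ⇔-trans ∈-tabulate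
  (reflect-∧ T-not-≡ (reflect-all λ j →
    reflect-⇒ (reflect-< {i = j} {i}) (reflect-< {i = absv w j} {absv w i})))

∈-Rmil : ∀ (w : SignedWord n) {v} → v ∈ Rmil w ⇔ IsRmil w v
∈-Rmil w {v} = ⇔-trans ∈-tabulate (reflect-any λ i →
  reflect-∧ reflect-≟ (reflect-∧ T-not-≡
    (reflect-all λ j → reflect-⇒ (reflect-< {i = i} {j}) (reflect-< {i = v} {absv w j}))))

-- Cycles of an injective self-map of a finite set.

module _ {π : Fin n → Fin n} (π-inj : Injective _≡_ _≡_ π) where

  fold-cancel : ∀ {x} a d → fold x π a ≡ fold x π (a ℕ.+ d) → x ≡ fold x π d
  fold-cancel zero    d eq = eq
  fold-cancel (suc a) d eq = fold-cancel a d (π-inj eq)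

  -- By pigeonhole two of the n + 1 iterates of `x` up to the n-th agree; cancelling the common
  -- applications of `π` brings the coincidence back to `x`.
  cycle-length : ∀ x → ∃[ m ] m ℕ.< n × π (fold x π m) ≡ x
  cycle-length x with a , b , a<b , eq ← pigeonhole (ℕ.n<1+n n) (fold x π ∘ toℕ) =
    k
    , ℕ.≤-trans (ℕ.m≤n+m (suc k) (toℕ a)) (ℕ.≤-trans (ℕ.≤-reflexive a+1+k≡b) (ℕ.s≤s⁻¹ (toℕ<n b)))
    , sym (fold-cancel (toℕ a) (suc k) (trans eq (cong (fold x π) (sym a+1+k≡b))))
    where
    -- The cycle closes after b - a = k + 1 steps, the last of which is written separately in the
    -- statement.
    k = toℕ b ℕ.∸ suc (toℕ a)
    a+1+k≡b : toℕ a ℕ.+ suc k ≡ toℕ b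
    a+1+k≡b = trans (ℕ.+-suc (toℕ a) k) (ℕ.m+[n∸m]≡n a<b)

  injective⇒surjective : ∀ y → ∃[ x ] π x ≡ y
  injective⇒surjective y with m , _ , eq ← cycle-length y = fold y π m , eq

fold-pull : ∀ {A : Set} (f : A → A) x m → fold (f x) f m ≡ f (fold x f m)
fold-pull f x zero    = refl
fold-pull f x (suc m) = cong f (fold-pull f x m)

-- The Boolean orbit test for `Cyc` agrees with closed walks.

negatives : SignedWord n → List (Fin n) → List (Fin n)
negatives w = foldr (λ x r → if neg w x then x ∷ r else r) []

orbitTail-stop : ∀ (w : SignedWord n) i k → orbitTail w i k i ≡ []
orbitTail-stop w i zero    = refl
orbitTail-stop w i (suc k) with i ≟ i
... | yes _  = refl
... | no i≢i = contradiction refl i≢i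

-- The counterpart of `Return w i x e` for the walk computed with fuel `k`; as `e = true` means odd,
-- evenness is compared with `not e`.
OrbitTailOk : SignedWord n → Fin n → ℕ → Fin n → Bool → Set
OrbitTailOk w i k x e =
  T (all (λ y → not (y <ᶠ i)) tail) × even (length (negatives w tail)) ≡ not e
  where tail = orbitTail w i k x

even-negatives-∷ : ∀ (w : SignedWord n) x xs →
  even (length (negatives w (x ∷ xs))) ≡ neg w x xor even (length (negatives w xs))
even-negatives-∷ w x xs with neg w x
... | true  = refl
... | false = refl

reflect-≥ : ∀ {i x : Fin n} → T (not (x <ᶠ i)) ⇔ i Fin.≤ x
reflect-≥ {i = i} {x} = ⇔-trans (reflect-not (reflect-< {i = x} {i})) (mk⇔ ℕ.≮⇒≥ ℕ.≤⇒≯)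

xor-shift : ∀ a {b c} → a xor b ≡ c → b ≡ a xor c
xor-shift true  refl = sym (not-involutive _)
xor-shift false refl = refl

-- A detour through an inserted letter meets the signs `s` and `s xor a`, which together amount to
-- the sign `a` of the displaced letter.
xor-cancel : ∀ s {a e} → s xor ((s xor a) xor e) ≡ a xor e
xor-cancel true  {true}  = refl
xor-cancel true  {false} = not-involutive _
xor-cancel false         = refl

-- Compares the parity conditions at a cycle minimum `p` whose letter, of sign `a`, is displaced by
-- an inserted letter of sign `s`.
xor-conjugate : ∀ s {a e} → (s xor a) xor e ≡ s ⇔ e ≡ a
xor-conjugate s {a} {e} = mk⇔
  (λ eq → trans (xor-shift (s xor a) eq) (trans (cong (_xor s) (xor-comm s a)) (xor-xor a s)))
  (λ { refl → xor-xor s a })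
  where
  xor-xor : ∀ x y → (x xor y) xor y ≡ x
  xor-xor x y = trans (xor-assoc x y y) (trans (cong (x xor_) (xor-same y)) (xor-identityʳ x))

not-xor : ∀ a {b} → a xor not b ≡ not (a xor b)
not-xor true  = refl
not-xor false = refl

-- Induction on a number `m` of steps after which the walk is at `i`; fuel `k ≥ m` ensures that
-- `orbitTail` stops by reaching `i` and is not cut off.
Return⇔OrbitTailOk : ∀ (w : SignedWord n) i m k x → m ℕ.≤ k → fold x (absv w) m ≡ i →
  ∀ e → Return w i x e ⇔ OrbitTailOk w i k x e
Return⇔OrbitTailOk w i m k x m≤k eq e with x ≟ i
Return⇔OrbitTailOk w i m k .i m≤k eq e | yes refl rewrite orbitTail-stop w i k = mk⇔ ⇒ (⇐ ∘ proj₂)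
  where
  ⇒ : Return w i i e → T true × true ≡ not e
  ⇒ stop           = _ , refl
  ⇒ (step i<i _ _) = contradiction i<i (ℕ.<-irrefl refl)
  ⇐ : ∀ {e} → true ≡ not e → Return w i i e
  ⇐ {false} _ = stop
Return⇔OrbitTailOk w i zero    k       x m≤k       eq e | no x≢i = contradiction eq x≢i
-- The test is repeated because `orbitTail` unfolds to its own test only now that the fuel is a
-- successor.
Return⇔OrbitTailOk w i (suc m) (suc k) x (s≤s m≤k) eq e | no x≢i with x ≟ i
... | yes x≡i = contradiction x≡i x≢i
... | no  _   = mk⇔ ⇒ ⇐
  where
  rest = orbitTail w i k (absv w x)
  ih = Return⇔OrbitTailOk w i m k (absv w x) m≤k (trans (fold-pull (absv w) x m) eq)
  ⇒ : ∀ {e} → Return w i x e → _ × _ ≡ not e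
  ⇒ stop = contradiction refl x≢i
  ⇒ (step {e = e} i<x refl r) with t , p ← to (ih e) r =
    from T-∧ (from (reflect-≥ {i = i} {x}) (ℕ.<⇒≤ i<x) , t)
    , trans (even-negatives-∷ w x rest) (trans (cong (neg w x xor_) p) (not-xor (neg w x)))
  ⇐ : _ × _ ≡ not e → Return w i x e
  ⇐ (t , p) = subst (Return w i x) (sym (xor-shift (neg w x) refl))
    -- The orbit test gives only `i ≤ x`; strictness comes from `x≢i`.
    (step (ℕ.≤∧≢⇒< (to (reflect-≥ {i = i} {x}) (proj₁ (to T-∧ t))) (x≢i ∘ sym ∘ toℕ-injective)) refl
      (from (ih (neg w x xor e)) (proj₂ (to (T-∧ {not (x <ᶠ i)}) t) ,
        trans (xor-shift (neg w x) (trans (sym (even-negatives-∷ w x rest)) p)) (not-xor (neg w x)))))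

-- From `absv w i` the walk is at `i` after m < n steps, so the fuel n used by `orbit` suffices.
∈-Cyc : ∀ (w : SignedWord n) → AbsInjective w → ∀ {i} → i ∈ Cyc w ⇔ IsCyc w i
∈-Cyc {n} w inj {i} with m , m<n , eq ← cycle-length inj i = ⇔-trans ∈-tabulate (mk⇔
  (λ t → let t₁ , t₂ = to T-∧ t in from tail (proj₂ (to T-∧ t₁) ,
     to (T-even-flip (neg w i)) (subst T flip t₂)))
  (λ r → let t , p = to tail r in from T-∧ (from T-∧ (from (reflect-≥ {i = i} {i}) ℕ.≤-refl , t) ,
     subst T (sym flip) (from (T-even-flip (neg w i)) p))))
  where
  tail = Return⇔OrbitTailOk w i m n (absv w i) (ℕ.<⇒≤ m<n)
    (trans (fold-pull (absv w) i m) eq) (neg w i)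
  rest = even (length (negatives w (orbitTail w i n (absv w i))))
  flip : even (length (negatives w (orbit w i))) ≡ (if neg w i then not rest else rest)
  flip with neg w i
  ... | true  = refl
  ... | false = refl

-- Inversion of signed permutations.

record Inverse (w u : SignedWord n) : Set where
  constructor _,_
  field
    left  : ∀ i → lookup u (absv w i) ≡ (neg w i , i)
    right : ∀ v → lookup w (absv u v) ≡ (neg u v , v)

Inverse-sym : ∀ {w u : SignedWord n} → Inverse w u → Inverse u w
Inverse-sym (left , right) = right , left

∃-inverse : ∀ (w : SignedWord n) → AbsInjective w → ∃[ u ] Inverse w u
∃-inverse {n} w inj = u , (left , right)
  where
  pos : Fin n → Fin n
  pos v = proj₁ (injective⇒surjective inj v)
  pos-correct : ∀ v → absv w (pos v) ≡ v
  pos-correct v = proj₂ (injective⇒surjective inj v)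
  u = tabulate λ v → neg w (pos v) , pos v
  lookup-u : ∀ v → lookup u v ≡ (neg w (pos v) , pos v)
  lookup-u = lookup∘tabulate _
  left : ∀ i → lookup u (absv w i) ≡ (neg w i , i)
  left i = trans (lookup-u (absv w i)) (cong (λ j → neg w j , j) (inj (pos-correct (absv w i))))
  right : ∀ v → lookup w (absv u v) ≡ (neg u v , v)
  right v rewrite lookup-u v = cong (neg w (pos v) ,_) (pos-correct v)

Inverse-injective : ∀ {w u : SignedWord n} → Inverse w u → AbsInjective u
Inverse-injective {w = w} (_ , right) eq =
  trans (sym (cong proj₂ (right _))) (trans (cong (absv w) eq) (cong proj₂ (right _)))

Inverse-unique : ∀ {w w′ u : SignedWord n} → Inverse w u → Inverse w′ u → w ≡ w′
Inverse-unique {w = w} {w′} {u} (left , _) (_ , right′) = vec-ext λ i → sym (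
  trans (cong (lookup w′) (sym (cong proj₂ (left i))))
  (trans (right′ (absv w i)) (cong (_, absv w i) (cong proj₁ (left i)))))

-- Inversion exchanges positions and values and keeps signs. That later letters are larger becomes,
-- by contraposition, that smaller values stand earlier.
Rmil-inverse : ∀ {w u : SignedWord n} → Inverse w u → ∀ v → IsRmil w v ⇔ IsLmap u v
Rmil-inverse {w = w} {u} inv@(left , right) v = mk⇔ ⇒ ⇐
  where
  ⇒ : IsRmil w v → IsLmap u v
  ⇒ (i , refl , pos , later) = trans (cong proj₁ (left i)) pos , earlier
    where
    earlier : ∀ v′ → v′ < v → absv u v′ < absv u v
    earlier v′ v′<v with <-cmp (absv u v′) (absv u v)
    ... | tri< lt _ _ = lt
    ... | tri≈ _ eq _ = contradiction v′<v (<-irrefl (Inverse-injective inv eq))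
    ... | tri> _ _ gt = contradiction v′<v (<-asym (subst (v <_) (cong proj₂ (right v′))
          (later (absv u v′) (subst (_< absv u v′) (cong proj₂ (left i)) gt))))
  ⇐ : IsLmap u v → IsRmil w v
  ⇐ (pos , earlier) = absv u v , cong proj₂ (right v) , trans (cong proj₁ (right v)) pos , later
    where
    later : ∀ j → absv u v < j → v < absv w j
    later j lt with <-cmp v (absv w j)
    ... | tri< v<wj _ _ = v<wj
    ... | tri≈ _ refl _ = contradiction lt (<-irrefl (cong proj₂ (left j)))
    ... | tri> _ _ wj<v = contradiction lt (<-asym
          (subst (_< absv u v) (cong proj₂ (left j)) (earlier _ wj<v)))

-- Walking along the cycle of w from x back to i, accumulate the reversed walk of u;
-- the parities seen on the two sides of x are kept equal.
Return-reverse : ∀ {w u : SignedWord n} → Inverse w u → ∀ {i x e a} →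
  Return w i x e → Return u i (absv u x) a → neg u x xor a ≡ e → IsCyc u i
Return-reverse {u = u} _ {i} stop back eq =
  -- The flag of `stop` is `false`, so `eq` identifies the accumulated parity with the sign of `u`
  -- at `i`.
  subst (Return u i (absv u i)) (trans (xor-shift (neg u i) eq) (xor-identityʳ _)) back
Return-reverse {w = w} {u} inv@(left , _) {i} (step {x = x} {d = d} i<x refl r) back eq =
  Return-reverse inv r
    (subst (λ z → Return u i z _) (sym (cong proj₂ (left x))) (step i<x refl back))
    (trans (cong₂ _xor_ (cong proj₁ (left x)) eq) (sym (xor-shift d refl)))

-- The inverse runs through the same cycles backwards with the same signs. The accumulated walk
-- starts out empty because `absv u (absv w i)` is `i`.
Cyc-inverse : ∀ {w u : SignedWord n} → Inverse w u → ∀ {i} → IsCyc w i → IsCyc u i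
Cyc-inverse {u = u} inv@(left , _) {i} r = Return-reverse inv r
  (subst (λ z → Return u i z false) (sym (cong proj₂ (left i))) stop)
  (trans (xor-identityʳ _) (cong proj₁ (left i)))

-- The order on `Fin (suc n)` and two rules for enlarging a set.

inject₁-< : ∀ {i j : Fin n} → inject₁ i < inject₁ j ⇔ i < j
inject₁-< {i = i} {j} = mk⇔ (subst₂ ℕ._<_ (toℕ-inject₁ i) (toℕ-inject₁ j))
                            (subst₂ ℕ._<_ (sym (toℕ-inject₁ i)) (sym (toℕ-inject₁ j)))

inject₁<fromℕ : ∀ (i : Fin n) → inject₁ i < fromℕ n
inject₁<fromℕ {n} i = subst₂ ℕ._<_ (sym (toℕ-inject₁ i)) (sym (toℕ-fromℕ n)) (toℕ<n i)

fromℕ≮ : ∀ {i : Fin (suc n)} → ¬ fromℕ n < i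
fromℕ≮ = ℕ.≤⇒≯ (≤fromℕ _)

Return-fromℕ : ∀ {w : SignedWord (suc n)} {x e} → Return w (fromℕ n) x e → x ≡ fromℕ n × e ≡ false
Return-fromℕ stop           = refl , refl
Return-fromℕ (step lt _ _)  = contradiction lt fromℕ≮

<⇒inject₁ : ∀ {i j : Fin (suc n)} → i < j → ∃[ k ] i ≡ inject₁ k
<⇒inject₁ {i = i} i<j with view i
... | ‵fromℕ     = contradiction i<j fromℕ≮
... | ‵inject₁ k = k , refl

punchIn-< : ∀ v {x y : Fin n} → punchIn v x < punchIn v y ⇔ x < y
punchIn-< v {x} {y} = mk⇔
  (λ lt → ℕ.≰⇒> (ℕ.<⇒≱ lt ∘ punchIn-mono-≤ v y x))
  (λ lt → ℕ.≰⇒> (ℕ.<⇒≱ lt ∘ punchIn-cancel-≤ v y x))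

-- `punchIn v` shifts only values from `v` upward. This version bounds the value after the shift,
-- the next one the value before it.
punchIn<⇒≡inject₁ : ∀ v (x : Fin n) → punchIn v x < v → punchIn v x ≡ inject₁ x
punchIn<⇒≡inject₁ (suc v) zero    _        = refl
punchIn<⇒≡inject₁ (suc v) (suc x) (s≤s lt) = cong suc (punchIn<⇒≡inject₁ v x lt)

inject₁<⇒punchIn≡ : ∀ v (x : Fin n) → inject₁ x < v → punchIn v x ≡ inject₁ x
inject₁<⇒punchIn≡ (suc v) zero    _        = refl
inject₁<⇒punchIn≡ (suc v) (suc x) (s≤s lt) = cong suc (inject₁<⇒punchIn≡ v x lt)

-- The rule obeyed by `Lmap` under `Append` and by `Cyc` under `CycleInsert`.
AddMax : (s : Bool) (p : Fin (suc n)) → (Fin n → Set) → Fin (suc n) → Set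
AddMax s p S i = (i ≡ fromℕ _ × p ≡ fromℕ _ × s ≡ false) ⊎ (∃[ j ] i ≡ inject₁ j × S j)

-- The rule obeyed by `Rmil` under `Append` and by `Lmap` under `CycleInsert`.
AddCut : (s : Bool) (p : Fin (suc n)) → (Fin n → Set) → Fin (suc n) → Set
AddCut s p S i = (i ≡ p × s ≡ false) ⊎ (∃[ j ] i ≡ inject₁ j × i < p × S j)

AddMax-cong : ∀ {s} {p : Fin (suc n)} {S S′} → (∀ j → S j ⇔ S′ j) →
  ∀ i → AddMax s p S i ⇔ AddMax s p S′ i
AddMax-cong h i = mk⇔ (Sum.map₂ λ (j , eq , q) → j , eq , to (h j) q)
                      (Sum.map₂ λ (j , eq , q) → j , eq , from (h j) q)

AddCut-cong : ∀ {s} {p : Fin (suc n)} {S S′} → (∀ j → S j ⇔ S′ j) →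
  ∀ i → AddCut s p S i ⇔ AddCut s p S′ i
AddCut-cong h i = mk⇔ (Sum.map₂ λ (j , eq , lt , q) → j , eq , lt , to (h j) q)
                      (Sum.map₂ λ (j , eq , lt , q) → j , eq , lt , from (h j) q)

-- Appending a last letter.

-- w is σ followed by the letter (s , v), the values ≥ v of σ being shifted up.
record Append (σ : SignedWord n) (s : Bool) (v : Fin (suc n)) (w : SignedWord (suc n)) : Set where
  constructor _,_
  field
    init : ∀ i → lookup w (inject₁ i) ≡ (neg σ i , punchIn v (absv σ i))
    last : lookup w (fromℕ n) ≡ (s , v)

module _ {σ : SignedWord n} {s : Bool} {v : Fin (suc n)} {w : SignedWord (suc n)}
         (app : Append σ s v w) where
  open Append app

  private
    absv-init : ∀ i → absv w (inject₁ i) ≡ punchIn v (absv σ i)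
    absv-init = cong proj₂ ∘ init
    neg-init : ∀ i → neg w (inject₁ i) ≡ neg σ i
    neg-init = cong proj₁ ∘ init
    init-< : ∀ {i j} → absv w (inject₁ i) < absv w (inject₁ j) ⇔ absv σ i < absv σ j
    init-< {i} {j} rewrite absv-init i | absv-init j = punchIn-< v

  Append-injective : AbsInjective w → AbsInjective σ
  Append-injective inj {i} {j} eq = inject₁-injective (inj
    (trans (absv-init i) (trans (cong (punchIn v) eq) (sym (absv-init j)))))

  -- The condition at an old position looks only to the left, where standardization keeps the
  -- relative order.
  Append-Lmap : AbsInjective w → ∀ i → IsLmap w i ⇔ AddMax s v (IsLmap σ) i
  Append-Lmap inj i = mk⇔ ⇒ ⇐
    where
    ⇒ : ∀ {i} → IsLmap w i → AddMax s v (IsLmap σ) i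
    ⇒ {i} (pos , big) with view i
    ... | ‵inject₁ j = inj₂ (j , refl , trans (sym (neg-init j)) pos ,
          λ k k<j → to init-< (big (inject₁ k) (from inject₁-< k<j)))
    -- Some position `k` holds the largest value; the last letter exceeds all earlier ones only if
    -- `k` is the last position.
    ... | ‵fromℕ with k , eq ← injective⇒surjective inj (fromℕ n) with view k
    ...   | ‵fromℕ     = inj₁
            (refl , trans (sym (cong proj₂ last)) eq , trans (sym (cong proj₁ last)) pos)
    ...   | ‵inject₁ k = contradiction (subst (_< _) eq (big (inject₁ k) (inject₁<fromℕ k))) fromℕ≮
    ⇐ : ∀ {i} → AddMax s v (IsLmap σ) i → IsLmap w i
    ⇐ (inj₁ (refl , refl , refl)) = cong proj₁ last , λ k k<top →
      subst (absv w k <_) (sym (cong proj₂ last)) (ℕ.≤∧≢⇒< (≤fromℕ _) λ eq →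
        <-irrefl (inj (trans (toℕ-injective eq) (sym (cong proj₂ last)))) k<top)
    ⇐ (inj₂ (j , refl , pos , big)) = trans (neg-init j) pos , below
      where
      below : ∀ k → k < inject₁ j → absv w k < absv w (inject₁ j)
      below k lt with k , refl ← <⇒inject₁ lt = from init-< (big k (to inject₁-< lt))

  -- The new letter is to the right of all others, so an old value survives exactly when it lies
  -- below `v`, and then it is not shifted.
  Append-Rmil : ∀ v′ → IsRmil w v′ ⇔ AddCut s v (IsRmil σ) v′
  Append-Rmil v′ = mk⇔ ⇒ ⇐
    where
    ⇒ : ∀ {v′} → IsRmil w v′ → AddCut s v (IsRmil σ) v′
    ⇒ (i , refl , pos , small) with view i
    ... | ‵fromℕ     = inj₁ (cong proj₂ last , trans (sym (cong proj₁ last)) pos)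
    ... | ‵inject₁ j = inj₂ (absv σ j
        , trans (absv-init j) (punchIn<⇒≡inject₁ v _ (subst (_< v) (absv-init j) wj<v)) , wj<v
        , j , refl , trans (sym (neg-init j)) pos
        , λ k j<k → to init-< (small (inject₁ k) (from inject₁-< j<k)))
      where wj<v = subst (absv w (inject₁ j) <_) (cong proj₂ last) (small (fromℕ n) (inject₁<fromℕ j))
    ⇐ : ∀ {v′} → AddCut s v (IsRmil σ) v′ → IsRmil w v′
    ⇐ (inj₁ (refl , refl)) =
      fromℕ n , cong proj₂ last , cong proj₁ last , λ j top<j → contradiction top<j fromℕ≮
    ⇐ (inj₂ (_ , refl , v′<v , j , refl , pos , small)) =
      inject₁ j , wj≡ , trans (neg-init j) pos , later
      where
      wj≡ = trans (absv-init j) (inject₁<⇒punchIn≡ v _ v′<v)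
      later : ∀ k → inject₁ j < k → inject₁ (absv σ j) < absv w k
      later k lt with view k
      ... | ‵fromℕ     = subst (_ <_) (sym (cong proj₂ last)) v′<v
      ... | ‵inject₁ k = subst (_< absv w (inject₁ k)) wj≡ (from init-< (small k (to inject₁-< lt)))

Append-functional : ∀ {σ : SignedWord n} {s v w w′} → Append σ s v w → Append σ s v w′ → w ≡ w′
Append-functional {w = w} {w′} (init , last) (init′ , last′) = vec-ext same
  where
  same : ∀ i → lookup w i ≡ lookup w′ i
  same i with view i
  ... | ‵fromℕ     = trans last (sym last′)
  ... | ‵inject₁ j = trans (init j) (sym (init′ j))

-- By injectivity the last value does not occur earlier, so `punchOut` can close the gap it leaves.
Append-surjective : ∀ (w : SignedWord (suc n)) → AbsInjective w → ∃[ σ ] ∃[ s ] ∃[ v ] Append σ s v w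
Append-surjective {n} w inj = σ , neg w (fromℕ n) , v , (init , refl)
  where
  v = absv w (fromℕ n)
  v≢ : ∀ i → v ≢ absv w (inject₁ i)
  v≢ i eq = fromℕ≢inject₁ (inj eq)
  letter : Fin n → Bool × Fin n
  letter i = neg w (inject₁ i) , punchOut (v≢ i)
  σ = tabulate letter
  init : ∀ i → lookup w (inject₁ i) ≡ (neg σ i , punchIn v (absv σ i))
  init i = sym (trans
    (cong (λ (d , a) → d , punchIn v a) (lookup∘tabulate letter i))
    (cong (neg w (inject₁ i) ,_) (punchIn-punchOut (v≢ i))))

-- Inserting the largest letter into a cycle.

-- u arises from τ by inserting the new largest letter into a cycle right after p
-- (as a new cycle if p is the new position); the letter displaced from p moves to the
-- last position with its sign multiplied by s, so that sign products of cycles are kept.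
record CycleInsert (τ : SignedWord n) (s : Bool) (p : Fin (suc n)) (u : SignedWord (suc n)) : Set where
  field
    at    : lookup u p ≡ (s , fromℕ n)
    off   : ∀ i → inject₁ i ≢ p → lookup u (inject₁ i) ≡ (neg τ i , inject₁ (absv τ i))
    moved : ∀ i → inject₁ i ≡ p → lookup u (fromℕ n) ≡ (s xor neg τ i , inject₁ (absv τ i))

  data Position : Fin (suc n) → Set where
    isAt    : Position p
    isOff   : ∀ {i} → inject₁ i ≢ p → Position (inject₁ i)
    isMoved : ∀ {i} → inject₁ i ≡ p → Position (fromℕ n)

  position : ∀ i → Position i
  position i with i ≟ p
  ... | yes refl = isAt
  ... | no i≢p with view i
  ...   | ‵inject₁ j = isOff i≢p
  ...   | ‵fromℕ with view p
  ...     | ‵fromℕ     = contradiction refl i≢p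
  ...     | ‵inject₁ q = isMoved {i = q} refl

  absv-≢p : ∀ {i} → i ≢ p → ∃[ j ] absv u i ≡ inject₁ j
  absv-≢p {i} i≢p with position i
  ... | isAt           = contradiction refl i≢p
  ... | isOff {j} j≢p  = _ , cong proj₂ (off j j≢p)
  ... | isMoved {q} eq = _ , cong proj₂ (moved q eq)

  absv-max : ∀ {i} → absv u i ≡ fromℕ n → i ≡ p
  absv-max {i} eq with i ≟ p
  ... | yes i≡p = i≡p
  ... | no  i≢p = contradiction (trans (sym eq) (proj₂ (absv-≢p i≢p))) fromℕ≢inject₁

  injective : AbsInjective τ → AbsInjective u
  injective inj {i} {j} eq with position i | position j
  ... | isAt  | _    = sym (absv-max (trans (sym eq) (cong proj₂ at)))
  ... | _     | isAt = absv-max (trans eq (cong proj₂ at))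
  ... | isOff {a} a≢p | isOff {b} b≢p = cong inject₁ (inj (inject₁-injective
        (trans (sym (cong proj₂ (off a a≢p))) (trans eq (cong proj₂ (off b b≢p))))))
  ... | isMoved _ | isMoved _ = refl
  -- The moved letter is the one `τ` has at `p`, so equal values would put `a` at `p`.
  ... | isOff {a} a≢p | isMoved {q} q≡p = contradiction (trans (cong inject₁ (inj (inject₁-injective
        (trans (sym (cong proj₂ (off a a≢p))) (trans eq (cong proj₂ (moved q q≡p))))))) q≡p) a≢p
  ... | isMoved {q} q≡p | isOff {a} a≢p = contradiction (trans (cong inject₁ (inj (inject₁-injective
        (trans (sym (cong proj₂ (off a a≢p))) (trans (sym eq) (cong proj₂ (moved q q≡p))))))) q≡p) a≢p

  -- The largest absolute value stands at `p`: it excludes every later position, while before `p`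
  -- the words `u` and `τ` agree.
  Lmap⇔ : ∀ i → IsLmap u i ⇔ AddCut s p (IsLmap τ) i
  Lmap⇔ i = mk⇔ ⇒ ⇐
    where
    below : ∀ {k j} → inject₁ k < p → inject₁ j < p →
      absv u (inject₁ k) < absv u (inject₁ j) ⇔ absv τ k < absv τ j
    below {k} {j} k<p j<p
      rewrite off k (λ eq → <-irrefl eq k<p) | off j (λ eq → <-irrefl eq j<p) = inject₁-<
    ⇒ : ∀ {i} → IsLmap u i → AddCut s p (IsLmap τ) i
    ⇒ {i} (pos , big) with <-cmp i p
    ... | tri≈ _ refl _ = inj₁ (refl , trans (sym (cong proj₁ at)) pos)
    ... | tri> _ _ p<i  = contradiction (subst (_< absv u i) (cong proj₂ at) (big p p<i)) fromℕ≮
    ... | tri< i<p _ _ with j , refl ← <⇒inject₁ i<p = inj₂ (j , refl , i<p ,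
          trans (sym (cong proj₁ (off j (λ eq → <-irrefl eq i<p)))) pos ,
          λ k k<j → let ik<ij = from inject₁-< k<j in
            to (below (ℕ.<-trans ik<ij i<p) i<p) (big (inject₁ k) ik<ij))
    ⇐ : ∀ {i} → AddCut s p (IsLmap τ) i → IsLmap u i
    ⇐ (inj₁ (refl , refl)) = cong proj₁ at , λ k k<p →
      let j , eq = absv-≢p (λ k≡p → <-irrefl k≡p k<p) in
      subst₂ _<_ (sym eq) (sym (cong proj₂ at)) (inject₁<fromℕ j)
    ⇐ (inj₂ (j , refl , j<p , pos , big)) =
      trans (cong proj₁ (off j (λ eq → <-irrefl eq j<p))) pos , smaller
      where
      smaller : ∀ k → k < inject₁ j → absv u k < absv u (inject₁ j)
      smaller k k<j with k , refl ← <⇒inject₁ k<j =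
        from (below (ℕ.<-trans k<j j<p) j<p) (big k (to inject₁-< k<j))

  detour : ∀ {i x e} → inject₁ x ≡ p → Return u (inject₁ i) (inject₁ (absv τ x)) e →
    Return u (inject₁ i) (fromℕ n) ((s xor neg τ x) xor e)
  detour {i} {x} x≡p r = step (inject₁<fromℕ i) (moved x x≡p) r

  -- A step of `τ` is one step of `u`, except that leaving `p` takes two, through the new position,
  -- which lies above every old `i`.
  Return⁺ : ∀ {i x e} → Return τ i x e → Return u (inject₁ i) (inject₁ x) e
  Return⁺ stop = stop
  Return⁺ {i} (step {x} {e = e} i<x refl r) with inject₁ x ≟ p
  ... | no x≢p  = step (from inject₁-< i<x) (off x x≢p) (Return⁺ r)
  ... | yes x≡p = subst (Return u (inject₁ i) (inject₁ x)) (xor-cancel s)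
        (step (from inject₁-< i<x) (trans (cong (lookup u) x≡p) at) (detour x≡p (Return⁺ r)))

  -- The endpoints are variables with equations so that `stop` can be matched: unification does not
  -- solve `inject₁ i = inject₁ x`.
  Return⁻ : ∀ {k i z x e} → k ≡ inject₁ i → z ≡ inject₁ x → Return u k z e → Return τ i x e
  Return⁻ {i = i} {x = x} refl eq stop with refl ← inject₁-injective {i = i} {x} eq = stop
  Return⁻ {i = i} {x = x} refl refl (step i<x eq r) with inject₁ x ≟ p
  ... | no x≢p with refl ← trans (sym eq) (off x x≢p) =
        step (to inject₁-< i<x) refl (Return⁻ refl refl r)
  ... | yes x≡p with trans (sym eq) (trans (cong (lookup u) x≡p) at)
  ...   | e with refl , y≡ ← ,-injective e with r
  -- A walk back to an old position cannot end at the new one; its next step must use the moved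
  -- letter.
  ...     | stop = contradiction (sym y≡) fromℕ≢inject₁
  ...     | step {e = e′} _ eq′ r′
            with refl ← trans (sym eq′) (trans (cong (lookup u) y≡) (moved x x≡p)) =
            subst (Return τ i x) (sym (xor-cancel s))
              (step (to inject₁-< i<x) refl (Return⁻ refl refl r′))

  -- Old cycles keep their minimum and their sign product. The new position is largest, hence a
  -- minimum only as a fixed point.
  Cyc⇔ : ∀ i → IsCyc u i ⇔ AddMax s p (IsCyc τ) i
  Cyc⇔ i = mk⇔ ⇒ ⇐
    where
    ⇒ : ∀ {i} → IsCyc u i → AddMax s p (IsCyc τ) i
    ⇒ {i} r with view i
    ... | ‵fromℕ with eq , pos ← Return-fromℕ r with refl ← absv-max eq =
          inj₁ (refl , refl , trans (sym (cong proj₁ at)) pos)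
    ... | ‵inject₁ j with inject₁ j ≟ p
    ...   | no j≢p = inj₂ (j , refl , subst (Return τ j _) (cong proj₁ (off j j≢p))
            (Return⁻ refl (cong proj₂ (off j j≢p)) r))
    -- Here the minimum is `p` itself, so the walk begins at the new position and its first step
    -- uses the moved letter.
    ...   | yes refl with subst₂ (Return u (inject₁ j)) (cong proj₂ at) (cong proj₁ at) r
    ...     | r′ = inj₂ (j , refl , from-max r′ refl refl)
      where
      from-max : ∀ {z f} → Return u (inject₁ j) z f → z ≡ fromℕ _ → f ≡ s →
        Return τ j (absv τ j) (neg τ j)
      from-max stop eq _ = contradiction (sym eq) fromℕ≢inject₁
      from-max (step _ eq r) refl f≡s with refl ← trans (sym eq) (moved j refl) =
        subst (Return τ j _) (to (xor-conjugate s) f≡s) (Return⁻ refl refl r)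
    ⇐ : ∀ {i} → AddMax s p (IsCyc τ) i → IsCyc u i
    ⇐ (inj₁ (refl , refl , refl)) =
      subst₂ (Return u p) (sym (cong proj₂ at)) (sym (cong proj₁ at)) stop
    ⇐ (inj₂ (j , refl , r)) with inject₁ j ≟ p
    ... | no j≢p = subst₂ (Return u (inject₁ j))
          (sym (cong proj₂ (off j j≢p))) (sym (cong proj₁ (off j j≢p))) (Return⁺ r)
    ... | yes refl = subst₂ (Return u (inject₁ j))
          (sym (cong proj₂ at)) (trans (from (xor-conjugate s) refl) (sym (cong proj₁ at)))
          (detour refl (Return⁺ r))

CycleInsert-surjective : ∀ (τ : SignedWord n) s p → ∃ (CycleInsert τ s p)
CycleInsert-surjective {n} τ s p = u , record { at = at ; off = off ; moved = moved }
  where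
  letter : ∀ {i : Fin (suc n)} → View i → Bool × Fin (suc n)
  -- A default that does not reach `u`, since the last position is overwritten below.
  letter ‵fromℕ       = false , fromℕ n
  letter (‵inject₁ j) = neg τ j , inject₁ (absv τ j)

  ext : SignedWord (suc n)
  ext = tabulate (letter ∘ view)

  lookup-ext : ∀ j → lookup ext (inject₁ j) ≡ (neg τ j , inject₁ (absv τ j))
  lookup-ext j = trans (lookup∘tabulate (letter ∘ view) (inject₁ j)) (cong letter (view-inject₁ j))

  displaced = s xor neg ext p , absv ext p
  u′ = ext [ fromℕ n ]≔ displaced
  -- The update at `p` comes last so that it prevails when `p` is the new position.
  u = u′ [ p ]≔ (s , fromℕ n)

  at : lookup u p ≡ (s , fromℕ n)
  at = lookup∘updateAt p u′

  off : ∀ i → inject₁ i ≢ p → lookup u (inject₁ i) ≡ (neg τ i , inject₁ (absv τ i))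
  off i i≢p = trans (lookup∘updateAt′ (inject₁ i) p i≢p u′)
    (trans (lookup∘updateAt′ (inject₁ i) (fromℕ n) (fromℕ≢inject₁ ∘ sym) ext) (lookup-ext i))

  moved : ∀ i → inject₁ i ≡ p → lookup u (fromℕ n) ≡ (s xor neg τ i , inject₁ (absv τ i))
  moved i refl = trans (lookup∘updateAt′ (fromℕ n) p fromℕ≢inject₁ u′)
    (trans (lookup∘updateAt (fromℕ n) ext) (cong (λ (d , y) → s xor d , y) (lookup-ext i)))

-- The largest letter of `u` reveals `p` and `s`; then the letters of `τ` are read off, the moved
-- one after undoing `s`.
CycleInsert-unique : ∀ {τ τ′ : SignedWord n} {s s′ p p′ u} →
  CycleInsert τ s p u → CycleInsert τ′ s′ p′ u → τ ≡ τ′ × s ≡ s′ × p ≡ p′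
CycleInsert-unique {τ = τ} {τ′} {s} {p = p} c c′
  with refl ← CycleInsert.absv-max c′ (cong proj₂ (CycleInsert.at c))
  with refl ← trans (sym (CycleInsert.at c)) (CycleInsert.at c′) = vec-ext same , refl , refl
  where
  module C = CycleInsert c
  module C′ = CycleInsert c′
  same : ∀ i → lookup τ i ≡ lookup τ′ i
  same i with inject₁ i ≟ p
  ... | no i≢p with eq₁ , eq₂ ← ,-injective (trans (sym (C.off i i≢p)) (C′.off i i≢p)) =
        cong₂ _,_ eq₁ (inject₁-injective eq₂)
  ... | yes i≡p with eq₁ , eq₂ ← ,-injective (trans (sym (C.moved i i≡p)) (C′.moved i i≡p)) =
        cong₂ _,_ (trans (xor-shift s eq₁) (sym (xor-shift s refl))) (inject₁-injective eq₂)

-- The correspondence making equal choices of sign and position at every size.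

Correspond : ∀ n → SignedWord n → SignedWord n → Set
Correspond zero    w u = ⊤
Correspond (suc n) w u = ∃[ σ ] ∃[ τ ] ∃[ s ] ∃[ p ]
  Append σ s p w × CycleInsert τ s p u × Correspond n σ τ

Correspond-total : ∀ n (w : SignedWord n) → AbsInjective w → ∃[ u ] AbsInjective u × Correspond n w u
Correspond-total zero    w inj = w , inj , _
Correspond-total (suc n) w inj
  with σ , s , p , app ← Append-surjective w inj
  with τ , τ-inj , corr ← Correspond-total n σ (Append-injective app inj)
  with u , ins ← CycleInsert-surjective τ s p =
  u , CycleInsert.injective ins τ-inj , σ , τ , s , p , app , ins , corr

-- The word `u` determines `τ`, `s` and `p`; by induction `τ` determines `σ`, and appending
-- `(s , p)` to `σ` gives `w`.
Correspond-unique : ∀ n {w w′ u : SignedWord n} → Correspond n w u → Correspond n w′ u → w ≡ w′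
Correspond-unique zero    {[]} {[]} _ _ = refl
Correspond-unique (suc n) (σ , τ , s , p , app , ins , corr) (σ′ , τ′ , s′ , p′ , app′ , ins′ , corr′)
  with refl , refl , refl ← CycleInsert-unique ins ins′
  with refl ← Correspond-unique n corr corr′ = Append-functional app app′

Correspond-stats : ∀ n {w u : SignedWord n} → AbsInjective w → Correspond n w u →
  (∀ i → IsLmap w i ⇔ IsCyc u i) × (∀ i → IsRmil w i ⇔ IsLmap u i)
Correspond-stats zero    _   _ = (λ ()) , (λ ())
Correspond-stats (suc n) inj (σ , τ , s , p , app , ins , corr)
  with ih₁ , ih₂ ← Correspond-stats n (Append-injective app inj) corr =
    (λ i → ⇔-trans (Append-Lmap app inj i)
      (⇔-trans (AddMax-cong ih₁ i) (⇔-sym (CycleInsert.Cyc⇔ ins i))))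
  , (λ i → ⇔-trans (Append-Rmil app i)
      (⇔-trans (AddCut-cong ih₂ i) (⇔-sym (CycleInsert.Lmap⇔ ins i))))

-- Equidistribution of the six pairs.

countPair-bijection : ∀ {S₁ S₂ T₁ T₂ : SignedWord n → Subset n} (R : Rel (SignedWord n) 0ℓ) →
  (∀ w → AbsInjective w → ∃[ u ] AbsInjective u × R w u) →
  (∀ {w w′ u} → R w u → R w′ u → w ≡ w′) →
  (∀ {w u} → AbsInjective w → AbsInjective u → R w u → S₁ w ≡ T₁ u × S₂ w ≡ T₂ u) →
  ∀ X Y → countPair n S₁ S₂ X Y ≡ countPair n T₁ T₂ X Y
countPair-bijection R total unique stats = countPair-cong R
  (λ w p → let u , q , r = total w (to (isSignedPerm⇔ w) p) in u , from (isSignedPerm⇔ u) q , r)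
  unique
  (λ {w} {u} p q → stats (to (isSignedPerm⇔ w) p) (to (isSignedPerm⇔ u) q))

countPair-inverse : ∀ {S₁ S₂ T₁ T₂ : SignedWord n → Subset n} →
  (∀ {w u} → AbsInjective w → AbsInjective u → Inverse w u → S₁ w ≡ T₁ u × S₂ w ≡ T₂ u) →
  ∀ X Y → countPair n S₁ S₂ X Y ≡ countPair n T₁ T₂ X Y
countPair-inverse = countPair-bijection Inverse
  (λ w inj → let u , inv = ∃-inverse w inj in u , Inverse-injective inv , inv)
  Inverse-unique

Rmil≡Lmap : ∀ {w u : SignedWord n} → Inverse w u → Rmil w ≡ Lmap u
Rmil≡Lmap {w = w} {u} inv = subset-ext λ v →
  ⇔-trans (∈-Rmil w) (⇔-trans (Rmil-inverse inv v) (⇔-sym (∈-Lmap u)))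

Cyc≡Cyc : ∀ {w u : SignedWord n} → AbsInjective w → AbsInjective u → Inverse w u → Cyc w ≡ Cyc u
Cyc≡Cyc {w = w} {u} w-inj u-inj inv = subset-ext λ i →
  ⇔-trans (∈-Cyc w w-inj) (⇔-trans
    (mk⇔ (Cyc-inverse inv) (Cyc-inverse (Inverse-sym inv))) (⇔-sym (∈-Cyc u u-inj)))

Cyc-Rmil∼Cyc-Lmap : ∀ (X Y : Subset n) → countPair n Cyc Rmil X Y ≡ countPair n Cyc Lmap X Y
Cyc-Rmil∼Cyc-Lmap = countPair-inverse λ p q inv → Cyc≡Cyc p q inv , Rmil≡Lmap inv

Rmil-Lmap∼Lmap-Rmil : ∀ (X Y : Subset n) → countPair n Rmil Lmap X Y ≡ countPair n Lmap Rmil X Y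
Rmil-Lmap∼Lmap-Rmil = countPair-inverse λ _ _ inv → Rmil≡Lmap inv , sym (Rmil≡Lmap (Inverse-sym inv))

Lmap-Rmil∼Cyc-Lmap : ∀ (X Y : Subset n) → countPair n Lmap Rmil X Y ≡ countPair n Cyc Lmap X Y
Lmap-Rmil∼Cyc-Lmap {n} = countPair-bijection (Correspond n) (Correspond-total n) (Correspond-unique n)
  λ {w} {u} w-inj u-inj corr → let Lmap⇔ , Rmil⇔ = Correspond-stats n w-inj corr in
    (subset-ext λ i → ⇔-trans (∈-Lmap w) (⇔-trans (Lmap⇔ i) (⇔-sym (∈-Cyc u u-inj))))
  , (subset-ext λ i → ⇔-trans (∈-Rmil w) (⇔-trans (Rmil⇔ i) (⇔-sym (∈-Lmap u))))

countPair-swap : ∀ (S₁ S₂ : SignedWord n → Subset n) X Y → countPair n S₁ S₂ X Y ≡ countPair n S₂ S₁ Y X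
countPair-swap {n} S₁ S₂ X Y = cong length (filter-≐
  (λ w → T? (isSignedPerm w) ×-dec (≡-dec _≟ᵇ_ (S₁ w) X ×-dec ≡-dec _≟ᵇ_ (S₂ w) Y))
  (λ w → T? (isSignedPerm w) ×-dec (≡-dec _≟ᵇ_ (S₂ w) Y ×-dec ≡-dec _≟ᵇ_ (S₁ w) X))
  (map₂ swap , map₂ swap) (allSignedWords n))

theorem3p8 : (n : ℕ) → 1 ≤ n → (X Y : Subset n) →
    (countPair n Cyc Rmil X Y ≡ countPair n Cyc Lmap X Y)
    × (countPair n Cyc Rmil X Y ≡ countPair n Rmil Lmap X Y)
    × (countPair n Cyc Rmil X Y ≡ countPair n Lmap Rmil X Y)
    × (countPair n Cyc Rmil X Y ≡ countPair n Lmap Cyc X Y)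
    × (countPair n Cyc Rmil X Y ≡ countPair n Rmil Cyc X Y)
theorem3p8 n _ X Y =
  CR≡CL , trans CR≡LR (sym (Rmil-Lmap∼Lmap-Rmil X Y)) , CR≡LR , CR≡LC , trans CR≡LC LC≡RC
  where
  open ≡-Reasoning
  CR≡CL = Cyc-Rmil∼Cyc-Lmap X Y
  CR≡LR = trans CR≡CL (sym (Lmap-Rmil∼Cyc-Lmap X Y))
  -- Exchanging `X` and `Y` allows the correspondence to be used a second time, on the pairs in
  -- reversed order.
  CR≡LC = begin
    countPair n Cyc Rmil X Y ≡⟨ CR≡LR ⟩
    countPair n Lmap Rmil X Y ≡⟨ Rmil-Lmap∼Lmap-Rmil X Y ⟨
    countPair n Rmil Lmap X Y ≡⟨ countPair-swap Rmil Lmap X Y ⟩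
    countPair n Lmap Rmil Y X ≡⟨ Lmap-Rmil∼Cyc-Lmap Y X ⟩
    countPair n Cyc Lmap Y X ≡⟨ countPair-swap Cyc Lmap Y X ⟩
    countPair n Lmap Cyc X Y ∎
  LC≡RC = begin
    countPair n Lmap Cyc X Y ≡⟨ countPair-swap Lmap Cyc X Y ⟩
    countPair n Cyc Lmap Y X ≡⟨ Cyc-Rmil∼Cyc-Lmap Y X ⟨
    countPair n Cyc Rmil Y X ≡⟨ countPair-swap Cyc Rmil Y X ⟩
    countPair n Rmil Cyc X Y ∎
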